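{- Let $L$ be a relational language, let $\mathcal F$ be a set of finite irreducible $L$-structures, and let $\mathbf H$ be a countable $\mathcal F$-free $L$-structure (with vertex set $\omega$) universal for all countable $\mathcal F$-free $L$-structures. Assume that there are $\mathcal F$-free $L$-structures $\mathbf B$ and $\mathbf U$, each consisting of one vertex, and infinitely many pairwise non-isomorphic $\mathcal F$-free two-vertex $L$-structures $\mathbf C_0,\mathbf C_1,\dots$ such that in each $\mathbf C_i$ the first vertex induces a copy of $\mathbf B$ and the second (last) vertex induces a copy of $\mathbf U$. Then there exist an $\mathcal F$-free $L$-structure $\mathbf A$ on three vertices and a colouring $c:\binom{\mathbf H}{\mathbf A}\to\omega$ such that for every tree-like embedding $f:\mathbf H\to\mathbf H$, $c$ attains every value in $\omega$ on the set of embeddings $\mathbf A\to\mathbf H$ whose image lies in $f[\omega]$.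
   Context: Convention: every structure is countable, has vertex set some $n\in\omega$ or $\omega$ ordered naturally, embeddings are monotone (order-preserving) embeddings of $L$-structures, isomorphisms likewise respect the order; $\binom{\mathbf H}{\mathbf A}$ is the set of such embeddings $\mathbf A\to\mathbf H$. $\mathbf A$ is $\mathcal F$-free if no member of $\mathcal F$ embeds into it; universal for a class if every member of the class embeds into it. The Gaifman graph of a structure $\mathbf A$ joins distinct $x,y$ iff some tuple in some relation of $\mathbf A$ contains both; $\mathbf A$ is irreducible if its Gaifman graph is complete. For $X\subseteq\omega$, $\mathrm{tp}_{\mathbf H}(X)$ is the isomorphism type (respecting the order) of the substructure of $\mathbf H$ induced on $X$. An embedding $f:\mathbf H\to\mathbf H$ is tree-like if for every finite $X=\{x_0<\dots<x_m\}\subseteq\omega$, every $0\le i\le m$ and every $x\in\omega$ with $x>x_m$ there is $y>x_m$ such that $\mathrm{tp}_{\mathbf H}(f[X]\cup\{f(y)\})=\mathrm{tp}_{\mathbf H}(X\cup\{x\})$ and $\mathrm{tp}_{\mathbf H}(\{0,\dots,f(x_0)-1,f(y)\})=\mathrm{tp}_{\mathbf H}(\{0,\dots,f(x_0)-1,f(x_i)\})$. -}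

module Defs where

open import Level using (Level; 0ℓ; _⊔_) renaming (suc to lsuc)
open import Data.Fin as Fin using (Fin; toℕ)
open import Data.Nat using (ℕ; suc; _<_; _>_)
open import Data.Product using (∃-syntax; _×_)
open import Data.Vec using (Vec; map; lookup; head; last; tabulate; _∷ʳ_)
open import Data.Vec.Membership.Propositional using (_∈_)
open import Function.Bundles using (_⇔_)
open import Relation.Binary.Bundles using (Setoid)
open import Relation.Binary.PropositionalEquality using (_≡_; _≢_; refl; sym; trans)
open import Relation.Nullary using (¬_)

record Language : Set₁ where
  field
    Symbol : Set
    arity  : Symbol → ℕ

open Language public

-- Vertex sets are the ordinals n < ω and ω itself, with their natural order.

data Size : Set where
  fin : ℕ → Size
  ω   : Size

Vertex : Size → Set
Vertex (fin n) = Fin n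
Vertex ω       = ℕ

Before : (s : Size) → Vertex s → Vertex s → Set
Before (fin n) x y = x Fin.< y
Before ω       x y = x < y

record Structure (L : Language) (s : Size) : Set₁ where
  field
    rel : (R : Symbol L) → Vec (Vertex s) (arity L R) → Set

open Structure public

private
  variable
    L   : Language
    s t : Size
    ℓ   : Level

-- Injectivity follows from strict monotonicity, the orders being linear.

record Embedding (A : Structure L s) (B : Structure L t) : Set where
  field
    fun      : Vertex s → Vertex t
    monotone : ∀ x y → Before s x y → Before t (fun x) (fun y)
    relation : ∀ R xs → rel A R xs ⇔ rel B R (map fun xs)

open Embedding public

record _≅_ (A : Structure L s) (B : Structure L t) : Set where
  field
    embedding  : Embedding A B
    surjective : ∀ y → ∃[ x ] fun embedding x ≡ y

infix 4 _≅_

-- Embeddings H A is the set of embeddings A → H; two embeddings are equal when their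
-- underlying maps are.

Embeddings : Structure L s → Structure L t → Setoid 0ℓ 0ℓ
Embeddings H A = record
  { Carrier       = Embedding A H
  ; _≈_           = λ e e′ → ∀ v → fun e v ≡ fun e′ v
  ; isEquivalence = record
    { refl  = λ v → refl
    ; sym   = λ p v → sym (p v)
    ; trans = λ p q v → trans (p v) (q v)
    }
  }

GaifmanEdge : Structure L s → Vertex s → Vertex s → Set
GaifmanEdge A x y = x ≢ y × (∃[ R ] ∃[ xs ] rel A R xs × x ∈ xs × y ∈ xs)

Irreducible : Structure L s → Set
Irreducible A = ∀ x y → x ≢ y → GaifmanEdge A x y

FiniteStructures : Language → (ℓ : Level) → Set (lsuc 0ℓ ⊔ lsuc ℓ)
FiniteStructures L ℓ = (n : ℕ) → Structure L (fin n) → Set ℓ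

Free : FiniteStructures L ℓ → Structure L s → Set (lsuc 0ℓ ⊔ ℓ)
Free {L = L} 𝓕 A = ∀ n (F : Structure L (fin n)) → 𝓕 n F → ¬ Embedding F A

Universal : FiniteStructures L ℓ → Structure L s → Set (lsuc 0ℓ ⊔ ℓ)
Universal {L = L} 𝓕 H = ∀ t (A : Structure L t) → Free 𝓕 A → Embedding A H

-- A finite set of vertices is given by its increasing enumeration.

Increasing : ∀ {n} → Vec ℕ n → Set
Increasing X = ∀ i j → i Fin.< j → lookup X i < lookup X j

-- For X increasing this is the substructure induced on X, with the i-th
-- element of X renamed to i.

induced : ∀ {n} → Structure L s → Vec (Vertex s) n → Structure L (fin n)
induced A X = record { rel = λ R xs → rel A R (map (lookup X) xs) }

SameType : ∀ {m n} → Structure L ω → Vec ℕ m → Vec ℕ n → Set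
SameType H X Y = induced H X ≅ induced H Y

-- {0, …, n-1}

below : (n : ℕ) → Vec ℕ n
below n = tabulate toℕ

-- All enumerations to which SameType is applied are increasing, because f is
-- monotone and x, y lie above the last element of X.

TreeLike : (H : Structure L ω) → Embedding H H → Set
TreeLike H f =
  ∀ m (X : Vec ℕ (suc m)) → Increasing X →
  ∀ (i : Fin (suc m)) x → x > last X →
  ∃[ y ] y > last X
       × SameType H (map (fun f) X ∷ʳ fun f y) (X ∷ʳ x)
       × SameType H (below (fun f (head X)) ∷ʳ fun f y)
                    (below (fun f (head X)) ∷ʳ fun f (lookup X i))

{-# OPTIONS --safe #-}

-- Two vertices p < q of H are compared through the least vertex v over which their pair
-- types (v, p) and (v, q) differ; the pair receives colour k when (v, p) has type C k.
-- Let a star with root b and leaves p, r, x of types C k, C (k + 1), C (k + 1) over b be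
-- embedded in H.  A tree-like f provides y such that f y looks like x over f b, f p, f r
-- and like f p over everything below f b.  So f p and f y first differ over f b, where f p
-- has type C k.  The leaves of a star are independent copies of U, hence f p, f r, f y
-- form a copy of A = U + U + U, whatever k is.

module Submission where

open import Defs
open import Level using (Level; 0ℓ)
open import Axiom.ExcludedMiddle using (ExcludedMiddle)
open import Data.Empty using (⊥-elim)
open import Data.Fin as Fin using (Fin; zero; suc; toℕ; fromℕ; fromℕ<; inject₁)
open import Data.Fin.Properties as Finₚ using (any?; toℕ-fromℕ<)
open import Data.Nat using (ℕ; suc; _≤_; _<_; z≤n; z<s; s<s)
open import Data.Nat.Properties as ℕₚ using (≤-<-trans; ≤-antisym)
open import Data.Product using (Σ-syntax; ∃-syntax; _×_; _,_; proj₁; proj₂)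
open import Data.Vec using (Vec; []; _∷_; [_]; map; lookup; _∷ʳ_)
open import Data.Vec.Membership.Propositional using (_∈_)
open import Data.Vec.Membership.Propositional.Properties using (∈-map⁺)
open import Data.Vec.Properties using (map-∘; map-cong; map-id; ∷-injective; lookup∘tabulate)
open import Data.Vec.Relation.Unary.Any using (here; there)
open import Function using (_∘_; const; id)
open import Function.Bundles using (_⇔_; mk⇔; Equivalence; _⟶ₛ_; _⟨$⟩_)
open import Function.Construct.Composition using (_⇔-∘_)
open import Function.Construct.Identity using (⇔-id)
open import Function.Construct.Symmetry using (⇔-sym)
open import Relation.Binary.Definitions using (tri<; tri≈; tri>)
open import Relation.Binary.PropositionalEquality using (_≡_; _≢_; refl; sym; trans; cong; cong₂; subst; subst₂; setoid)
open import Relation.Nullary using (¬_; Dec; yes; no; contradiction)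
open import Relation.Nullary.Decidable using (decidable-stable)

private
  variable
    ℓ       : Level
    S T V W : Set
    m n     : ℕ
    L       : Language
    s t u   : Size

-- Tuples and monotone maps of finite ordinals.

-- Transfers a fact about single entries to tuples: from an equality of two images of tuples, other
-- coordinatewise equalities are read off.
map-related : {f : S → V} {g : T → V} {h : S → W} {k : T → W} →
              (∀ a b → f a ≡ g b → h a ≡ k b) →
              (xs : Vec S n) (ys : Vec T n) → map f xs ≡ map g ys → map h xs ≡ map k ys
map-related r []       []       _  = refl
map-related r (x ∷ xs) (y ∷ ys) eq with ∷-injective eq
... | eqₓ , eqₓₛ = cong₂ _∷_ (r x y eqₓ) (map-related r xs ys eqₓₛ)

∈-map⁻ : (f : S → T) {y : T} (xs : Vec S n) → y ∈ map f xs → ∃[ x ] y ≡ f x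
∈-map⁻ f (x ∷ xs) (here eq) = x , eq
∈-map⁻ f (x ∷ xs) (there p) = ∈-map⁻ f xs p

lookup-∷ʳ-inject₁ : (xs : Vec S n) (z : S) (i : Fin n) → lookup (xs ∷ʳ z) (inject₁ i) ≡ lookup xs i
lookup-∷ʳ-inject₁ (x ∷ xs) z zero    = refl
lookup-∷ʳ-inject₁ (x ∷ xs) z (suc i) = lookup-∷ʳ-inject₁ xs z i

lookup-∷ʳ-fromℕ : (xs : Vec S n) (z : S) → lookup (xs ∷ʳ z) (fromℕ n) ≡ z
lookup-∷ʳ-fromℕ []       z = refl
lookup-∷ʳ-fromℕ (x ∷ xs) z = lookup-∷ʳ-fromℕ xs z

-- Induction on `x`: precomposing with `inject₁` gives the bound at the predecessor, and strict
-- monotonicity gains one more.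
monotone⇒inflationary : (f : Fin m → Fin n) → (∀ x y → x Fin.< y → f x Fin.< f y) →
                        ∀ x → toℕ x ≤ toℕ (f x)
monotone⇒inflationary f mono zero    = z≤n
monotone⇒inflationary f mono (suc x) =
  ≤-<-trans (monotone⇒inflationary (f ∘ inject₁) mono′ x)
            (mono (inject₁ x) (suc x) (s<s (ℕₚ.≤-reflexive (Finₚ.toℕ-inject₁ x))))
  where
  mono′ : ∀ a b → a Fin.< b → f (inject₁ a) Fin.< f (inject₁ b)
  mono′ a b a<b = mono (inject₁ a) (inject₁ b)
    (subst₂ _<_ (sym (Finₚ.toℕ-inject₁ a)) (sym (Finₚ.toℕ-inject₁ b)) a<b)

monotone⇒reflects : (f : Fin m → Fin n) → (∀ x y → x Fin.< y → f x Fin.< f y) →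
                    ∀ x y → f x Fin.< f y → x Fin.< y
monotone⇒reflects f mono x y fx<fy with Finₚ.<-cmp x y
... | tri< x<y _ _ = x<y
... | tri≈ _ refl _ = contradiction fx<fy (Finₚ.<-irrefl refl)
... | tri> _ _ y<x = contradiction fx<fy (Finₚ.<-asym (mono y x y<x))

-- Isomorphism and embeddings of ordered structures.

rel-cong : (A : Structure L s) {R : Symbol L} {xs ys : Vec (Vertex s) (arity L R)} →
           xs ≡ ys → rel A R xs ⇔ rel A R ys
rel-cong A refl = ⇔-id _

rel-reindex : (A : Structure L s) (h : S → T) {f : T → Vertex s} {g : S → Vertex s} →
              (∀ i → f (h i) ≡ g i) → ∀ {R} (xs : Vec S (arity L R)) →
              rel A R (map f (map h xs)) ⇔ rel A R (map g xs)
rel-reindex A h {f} eq xs = rel-cong A (trans (sym (map-∘ f h xs)) (map-cong eq xs))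

-- Says that the identity map is an isomorphism. For finite ordered structures this is the same as
-- `_≅_`, and it is easier to compose.
SameRel : Structure L s → Structure L s → Set
SameRel A B = ∀ R xs → rel A R xs ⇔ rel B R xs

SameRel-sym : {A B : Structure L s} → SameRel A B → SameRel B A
SameRel-sym p R xs = ⇔-sym (p R xs)

SameRel-trans : {A B C : Structure L s} → SameRel A B → SameRel B C → SameRel A C
SameRel-trans p q R xs = q R xs ⇔-∘ p R xs

-- Finite linear orders are rigid: the isomorphism `φ` and its inverse `ψ` are both inflationary, so
-- `φ x ≤ ψ (φ x) = x ≤ φ x`.
≅⇒SameRel : {A B : Structure L (fin n)} → A ≅ B → SameRel A B
≅⇒SameRel {n = n} {A = A} {B} iso R xs =
  rel-cong B (trans (map-cong φ-id xs) (map-id xs)) ⇔-∘ relation embedding R xs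
  where
  open _≅_ iso
  φ = fun embedding

  ψ : Fin n → Fin n
  ψ y = proj₁ (surjective y)

  φψ : ∀ y → φ (ψ y) ≡ y
  φψ y = proj₂ (surjective y)

  ψ-mono : ∀ x y → x Fin.< y → ψ x Fin.< ψ y
  ψ-mono x y x<y = monotone⇒reflects φ (monotone embedding) (ψ x) (ψ y)
    (subst₂ Fin._<_ (sym (φψ x)) (sym (φψ y)) x<y)

  φ-injective : ∀ x y → φ x ≡ φ y → x ≡ y
  φ-injective x y eq with Finₚ.<-cmp x y
  ... | tri< x<y _ _ = contradiction (monotone embedding x y x<y) (Finₚ.<-irrefl eq)
  ... | tri≈ _ x≡y _ = x≡y
  ... | tri> _ _ y<x = contradiction (monotone embedding y x y<x) (Finₚ.<-irrefl (sym eq))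

  φ-id : ∀ x → φ x ≡ x
  φ-id x = Finₚ.toℕ-injective (≤-antisym
    (subst (λ z → toℕ (φ x) ≤ toℕ z) (φ-injective _ _ (φψ (φ x)))
           (monotone⇒inflationary ψ ψ-mono (φ x)))
    (monotone⇒inflationary φ (monotone embedding) x))

SameRel⇒≅ : {A B : Structure L s} → SameRel A B → A ≅ B
SameRel⇒≅ {B = B} p = record
  { embedding  = record
    { fun      = id
    ; monotone = λ x y x<y → x<y
    ; relation = λ R xs → rel-cong B (sym (map-id xs)) ⇔-∘ p R xs
    }
  ; surjective = λ y → y , refl
  }

∘-embedding : {A : Structure L s} {B : Structure L t} {C : Structure L u} →
              Embedding B C → Embedding A B → Embedding A C
∘-embedding {C = C} g f = record
  { fun      = fun g ∘ fun f
  ; monotone = λ x y x<y → monotone g _ _ (monotone f x y x<y)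
  ; relation = λ R xs → rel-cong C (sym (map-∘ (fun g) (fun f) xs))
                        ⇔-∘ (relation g R (map (fun f) xs) ⇔-∘ relation f R xs)
  }

Embedding⇒SameRel : {A : Structure L (fin n)} {B : Structure L s} (e : Embedding A B)
                    (X : Vec (Vertex s) n) → (∀ i → fun e i ≡ lookup X i) →
                    SameRel A (induced B X)
Embedding⇒SameRel {B = B} e X eq R xs = rel-cong B (map-cong eq xs) ⇔-∘ relation e R xs

Free-source : {𝓕 : FiniteStructures L ℓ} {A : Structure L s} {B : Structure L t} →
              Embedding A B → Free 𝓕 B → Free 𝓕 A
Free-source e free n F F∈𝓕 e′ = free n F F∈𝓕 (∘-embedding e e′)

-- Pulls an embedding back along `l` when its image lies in that of `l`; the factor `h` is monotone
-- because `l` reflects the order.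
factor-embedding : ∀ {k} {F : Structure L (fin m)} {C : Structure L (fin n)}
                   {D : Structure L (fin k)} (l : Embedding C D) (e : Embedding F D) →
                   (h : Fin m → Fin n) → (∀ x → fun e x ≡ fun l (h x)) → Embedding F C
factor-embedding {D = D} l e h eq = record
  { fun      = h
  ; monotone = λ x y x<y → monotone⇒reflects (fun l) (monotone l) (h x) (h y)
                 (subst₂ Fin._<_ (eq x) (eq y) (monotone e x y x<y))
  ; relation = λ R xs → ⇔-sym (relation l R (map h xs))
                 ⇔-∘ (rel-cong D (trans (map-cong eq xs) (map-∘ (fun l) h xs))
                 ⇔-∘ relation e R xs)
  }

-- Free amalgams of two-vertex structures over a common root.

loops : (A : Structure L s) (B : Structure L t) {v : Vertex s} {w : Vertex t} →
        SameRel (induced A [ v ]) (induced B [ w ]) →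
        ∀ R (zs : Vec T (arity L R)) → rel A R (map (const v) zs) ⇔ rel B R (map (const w) zs)
loops A B {v} {w} p R zs =
  rel-cong B (sym (map-∘ (lookup [ w ]) (const zero) zs))
  ⇔-∘ (p R (map (const zero) zs)
  ⇔-∘ rel-cong A (map-∘ (lookup [ v ]) (const zero) zs))

-- The disjoint union of `n` copies of `U`: a related tuple stays at one vertex `i`, and `ws` is the
-- tuple of `U` it comes from.
copies : (n : ℕ) → Structure L (fin 1) → Structure L (fin n)
copies n U = record
  { rel = λ R xs → ∃[ i ] ∃[ ws ] xs ≡ map (const i) ws × rel U R ws }

leaf : Fin n → Fin 2 → Fin (suc n)
leaf i zero    = zero
leaf i (suc _) = suc i

leaf-monotone : (i : Fin n) → ∀ x y → x Fin.< y → leaf i x Fin.< leaf i y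
leaf-monotone i zero       (suc _)    _ = z<s
leaf-monotone i (suc zero) (suc zero) (s<s ())

leaf-injective : (i : Fin n) → ∀ a b → leaf i a ≡ leaf i b → a ≡ b
leaf-injective i zero       zero       _ = refl
leaf-injective i (suc zero) (suc zero) _ = refl

leaf-root : {i j : Fin n} → i ≢ j → ∀ a b → leaf i a ≡ leaf j b → a ≡ zero × b ≡ zero
leaf-root i≢j zero    zero    _    = refl , refl
leaf-root i≢j (suc _) (suc _) refl = contradiction refl i≢j

leaf-suc : {i j : Fin n} → ∀ b → suc i ≡ leaf j b → i ≡ j × suc zero ≡ b
leaf-suc (suc zero) refl = refl , refl

-- The free amalgam of the two-vertex structures C i over their common first vertex.

star : (Fin n → Structure L (fin 2)) → Structure L (fin (suc n))
star C = record
  { rel = λ R xs → ∃[ i ] ∃[ ys ] xs ≡ map (leaf i) ys × rel (C i) R ys }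

-- A tuple witnessing the Gaifman edge from `x` to `y` comes from a single `C j`. As it meets the
-- non-root vertex `suc i`, necessarily `j` is `i`, so `y` is sent into the same leaf.
irreducible-leaf : (C : Fin n → Structure L (fin 2)) {F : Structure L (fin m)} → Irreducible F →
                   (e : Embedding F (star C)) →
                   ∀ i x → fun e x ≡ suc i → ∀ y → ∃[ z ] fun e y ≡ leaf i z
irreducible-leaf C irr e i x ex y with x Fin.≟ y
... | yes refl = suc zero , ex
... | no x≢y with irr x y x≢y
... | _ , R , xs , r , x∈xs , y∈xs with Equivalence.to (relation e R xs) r
... | j , zs , eq , _
    with ∈-map⁻ (leaf j) zs (subst (fun e x ∈_) eq (∈-map⁺ (fun e) x∈xs))
       | ∈-map⁻ (leaf j) zs (subst (fun e y ∈_) eq (∈-map⁺ (fun e) y∈xs))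
... | a , exa | b , eyb with leaf-suc {i = i} a (trans (sym ex) exa)
... | refl , _ = b , eyb

module _ (C : Fin n → Structure L (fin 2))
         (roots : ∀ i j → SameRel (induced (C i) [ zero ]) (induced (C j) [ zero ])) where

  leaf-embedding : ∀ i → Embedding (C i) (star C)
  leaf-embedding i = record
    { fun      = leaf i
    ; monotone = leaf-monotone i
    ; relation = λ R ys → mk⇔ (λ r → i , ys , refl , r) (from R ys)
    }
    where
    from : ∀ R ys → rel (star C) R (map (leaf i) ys) → rel (C i) R ys
    from R ys (j , zs , eq , r) with i Fin.≟ j
    ... | yes refl = subst (rel (C i) R)
      (sym (trans (sym (map-id ys)) (trans (map-related (leaf-injective i) ys zs eq) (map-id zs)))) r
    -- Different leaves meet only in the root, so both tuples are constant there, and `roots` makes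
    -- `C i` and `C j` agree on such tuples.
    ... | no i≢j = subst (rel (C i) R) (sym ys≡0)
                     (Equivalence.from (loops (C i) (C j) (roots i j) R zs)
                       (subst (rel (C j) R) zs≡0 r))
      where
      ys≡0 : ys ≡ map (const zero) zs
      ys≡0 = trans (sym (map-id ys))
                   (map-related (λ a b → proj₁ ∘ leaf-root i≢j a b) ys zs eq)
      zs≡0 : zs ≡ map (const zero) zs
      zs≡0 = trans (sym (map-id zs))
               (trans (map-related (λ b a → proj₂ ∘ leaf-root i≢j a b ∘ sym) zs ys (sym eq))
                      (map-related (λ _ _ _ → refl) ys zs eq))

-- A related tuple of the star that avoids the root is constant at the last vertex of one `C i`, so
-- only the type `U` of that vertex matters.
leaves-embedding : (C : Fin n → Structure L (fin 2)) (U : Structure L (fin 1)) →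
                   (∀ i → SameRel (induced (C i) [ suc zero ]) U) →
                   Embedding (copies n U) (star C)
leaves-embedding {n = n} {L = L} C U tops = record
  { fun      = suc
  ; monotone = λ x y x<y → s<s x<y
  ; relation = λ R xs → mk⇔ (to R xs) (from R xs)
  }
  where
  top : ∀ i R (ws : Vec (Fin 1) (arity L R)) → rel (C i) R (map (const (suc zero)) ws) ⇔ rel U R ws
  top i R ws = tops i R ws ⇔-∘ rel-cong (C i) (map-cong (λ { zero → refl }) ws)

  to : ∀ R xs → rel (copies n U) R xs → rel (star C) R (map suc xs)
  to R xs (i , ws , refl , r) =
    i , map (const (suc zero)) ws
      , trans (sym (map-∘ suc (const i) ws)) (map-∘ (leaf i) (const (suc zero)) ws)
      , Equivalence.from (top i R ws) r

  from : ∀ R xs → rel (star C) R (map suc xs) → rel (copies n U) R xs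
  from R xs (i , ys , eq , r) =
    i , map (const zero) ys
      , trans (sym (map-id xs))
          (trans (map-related (λ a b → proj₁ ∘ leaf-suc b) xs ys eq)
                 (map-∘ (const i) (const zero) ys))
      , Equivalence.to (top i R (map (const zero) ys)) (subst (rel (C i) R) ys≡1 r)
    where
    ys≡1 : ys ≡ map (const (suc zero)) (map (const zero) ys)
    ys≡1 = trans (sym (map-id ys))
             (trans (sym (map-related (λ a b → proj₂ ∘ leaf-suc b) xs ys eq))
               (trans (map-related (λ _ _ _ → refl) xs ys eq)
                      (map-∘ (const (suc zero)) (const zero) ys)))

-- An irreducible structure that reaches a non-root vertex `suc i` lies within `C i`; otherwise it
-- sits at the root, hence within `C zero`. Either way it would embed into a free structure.
star-free : {𝓕 : FiniteStructures L ℓ} → (∀ k F → 𝓕 k F → Irreducible F) →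
            (C : Fin (suc n) → Structure L (fin 2)) →
            (∀ i j → SameRel (induced (C i) [ zero ]) (induced (C j) [ zero ])) →
            (∀ i → Free 𝓕 (C i)) → Free 𝓕 (star C)
star-free irr C roots free k F F∈𝓕 e
  with any? (λ x → any? (λ i → fun e x Fin.≟ suc i))
... | yes (x , i , ex) = free i k F F∈𝓕
  (factor-embedding (leaf-embedding C roots i) e (proj₁ ∘ inLeaf) (proj₂ ∘ inLeaf))
  where inLeaf = irreducible-leaf C (irr k F F∈𝓕) e i x ex
... | no noLeaf = free zero k F F∈𝓕
  (factor-embedding (leaf-embedding C roots zero) e (const zero) atRoot)
  where
  atRoot : ∀ x → fun e x ≡ zero
  atRoot x with fun e x in ex
  ... | zero  = refl
  ... | suc i = ⊥-elim (noLeaf (x , i , ex))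

-- The colouring by the first difference of two vertices.

below-pair : (H : Structure L ω) {a p q : ℕ} →
             SameType H (below a ∷ʳ p) (below a ∷ʳ q) →
             ∀ w → w < a → SameRel (induced H (w ∷ p ∷ [])) (induced H (w ∷ q ∷ []))
below-pair H {a} {p} {q} iso w w<a R xs =
  rel-reindex H h (look q) xs
  ⇔-∘ (≅⇒SameRel iso R (map h xs) ⇔-∘ ⇔-sym (rel-reindex H h (look p) xs))
  where
  h : Fin 2 → Fin (suc a)
  h zero    = inject₁ (fromℕ< w<a)
  h (suc _) = fromℕ a

  look : ∀ z i → lookup (below a ∷ʳ z) (h i) ≡ lookup (w ∷ z ∷ []) i
  look z zero = trans (lookup-∷ʳ-inject₁ (below a) z (fromℕ< w<a))
                  (trans (lookup∘tabulate toℕ (fromℕ< w<a)) (toℕ-fromℕ< w<a))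
  look z (suc zero) = lookup-∷ʳ-fromℕ (below a) z

module Colouring (em : ExcludedMiddle 0ℓ) (H : Structure L ω) (C : ℕ → Structure L (fin 2))
                 (distinct : ∀ i j → i ≢ j → ¬ (C i ≅ C j)) where

  Agree : ℕ → ℕ → ℕ → Set
  Agree p q v = SameRel (induced H (v ∷ p ∷ [])) (induced H (v ∷ q ∷ []))

  Codes : ℕ → ℕ → ℕ → Set
  Codes p q k = ∃[ v ] (∀ w → w < v → Agree p q w) × ¬ Agree p q v
                     × SameRel (induced H (v ∷ p ∷ [])) (C k)

  -- The least vertex of disagreement is unique, and the `C k` are pairwise non-isomorphic.
  Codes-unique : ∀ {p q k l} → Codes p q k → Codes p q l → k ≡ l
  Codes-unique {k = k} {l} (v , lo , ¬agree , ck) (v′ , lo′ , ¬agree′ , cl) with ℕₚ.<-cmp v v′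
  ... | tri< v<v′ _ _ = contradiction (lo′ v v<v′) ¬agree
  ... | tri> _ _ v′<v = contradiction (lo v′ v′<v) ¬agree′
  ... | tri≈ _ refl _ = decidable-stable (k ℕₚ.≟ l) λ k≢l →
    distinct k l k≢l (SameRel⇒≅ (SameRel-trans (SameRel-sym ck) cl))

  -- The decision is an argument so that `decode-Codes` can split on it; `em` supplies it in
  -- `colour`. Pairs without a code get the arbitrary value 0.
  decode : ∀ {p q} → Dec (∃[ k ] Codes p q k) → ℕ
  decode (yes (k , _)) = k
  decode (no _)        = 0

  colour : ℕ → ℕ → ℕ
  colour p q = decode {p} {q} em

  colour-Codes : ∀ {p q k} → Codes p q k → colour p q ≡ k
  colour-Codes {p} {q} {k} codes = decode-Codes em
    where
    decode-Codes : (d : Dec (∃[ k ] Codes p q k)) → decode d ≡ k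
    decode-Codes (yes (_ , codes′)) = Codes-unique codes′ codes
    decode-Codes (no none)          = contradiction (k , codes) none

-- Every colour on copies of `A` inside the image of a tree-like embedding.

theorem6p2 : ExcludedMiddle 0ℓ →
    ∀ {ℓ : Level} (L : Language)
    (𝓕 : FiniteStructures L ℓ) →
    (∀ n (F : Structure L (fin n)) → 𝓕 n F → Irreducible F) →
    ∀ (H : Structure L ω) → Free 𝓕 H → Universal 𝓕 H →
    ∀ (B U : Structure L (fin 1)) → Free 𝓕 B → Free 𝓕 U →
    ∀ (C : ℕ → Structure L (fin 2)) →
    (∀ i → Free 𝓕 (C i)) →
    (∀ i j → i ≢ j → ¬ (C i ≅ C j)) →
    (∀ i → induced (C i) [ zero ] ≅ B) →
    (∀ i → induced (C i) [ suc zero ] ≅ U) →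
    Σ[ A ∈ Structure L (fin 3) ]
    Free 𝓕 A ×
    (Σ[ c ∈ Embeddings H A ⟶ₛ setoid ℕ ]
    (∀ (f : Embedding H H) → TreeLike H f →
    ∀ (k : ℕ) →
    Σ[ e ∈ Embedding A H ]
    (∀ v → ∃[ w ] fun e v ≡ fun f w) × c ⟨$⟩ e ≡ k))
theorem6p2 em L 𝓕 irr H _ universal B U _ _ C free distinct first last =
  -- `A` is free because it embeds into a free star; the choice of the star for 0 is arbitrary.
  A , Free-source (leaves 0) (stars-free 0) , c , attained
  where
  open Colouring em H C distinct

  A : Structure L (fin 3)
  A = copies 3 U

  -- The colouring compares the first and last leaves, so these two must have different types over
  -- the root.
  leafTypes : ℕ → Fin 3 → ℕ
  leafTypes k zero    = k
  leafTypes k (suc _) = suc k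

  D : ℕ → Fin 3 → Structure L (fin 2)
  D k = C ∘ leafTypes k

  roots : ∀ k i j → SameRel (induced (D k i) [ zero ]) (induced (D k j) [ zero ])
  roots k i j = SameRel-trans (≅⇒SameRel (first _)) (SameRel-sym (≅⇒SameRel (first _)))

  leaves : ∀ k → Embedding A (star (D k))
  leaves k = leaves-embedding (D k) U (λ i → ≅⇒SameRel (last _))

  stars-free : ∀ k → Free 𝓕 (star (D k))
  stars-free k = star-free irr (D k) (roots k) (λ i → free _)

  c : Embeddings H A ⟶ₛ setoid ℕ
  c = record
    { to   = λ e → colour (fun e zero) (fun e (suc (suc zero)))
    ; cong = λ p → cong₂ colour (p zero) (p (suc (suc zero)))
    }

  attained : ∀ f → TreeLike H f → ∀ k →
             Σ[ e ∈ Embedding A H ] (∀ v → ∃[ w ] fun e v ≡ fun f w) × c ⟨$⟩ e ≡ k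
  attained f treeLike k = e , inImage , colour-Codes codes
    where
    d : Embedding (star (D k)) H
    d = universal (fin 4) (star (D k)) (stars-free k)

    x : Fin 4 → ℕ
    x = fun d

    X : Vec ℕ 3
    X = x zero ∷ x (suc zero) ∷ x (suc (suc zero)) ∷ []

    X-lookup : ∀ i → lookup X i ≡ x (inject₁ i)
    X-lookup zero             = refl
    X-lookup (suc zero)       = refl
    X-lookup (suc (suc zero)) = refl

    X-increasing : Increasing X
    X-increasing i j i<j = subst₂ _<_ (sym (X-lookup i)) (sym (X-lookup j))
      (monotone d (inject₁ i) (inject₁ j)
        (subst₂ _<_ (sym (Finₚ.toℕ-inject₁ i)) (sym (Finₚ.toℕ-inject₁ j)) i<j))

    -- `X` is the root with the first two leaves. The index `suc zero` makes `f y` imitate the image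
    -- of the first leaf below the image of the root, while `f y` plays the last leaf over `f[X]`.
    extension = treeLike 2 X X-increasing (suc zero) (x (suc (suc (suc zero))))
                  (monotone d _ _ (s<s (s<s z<s)))

    y : ℕ
    y = proj₁ extension

    y>last : x (suc (suc zero)) < y
    y>last = proj₁ (proj₂ extension)

    Y : Vec ℕ 4
    Y = map (fun f) X ∷ʳ fun f y

    -- The first type equality of tree-likeness: `Y` is again a copy of the star, with all its
    -- vertices in the image of `f`.
    star-Y : SameRel (star (D k)) (induced H Y)
    star-Y = SameRel-trans (Embedding⇒SameRel d (X ∷ʳ x (suc (suc (suc zero)))) d-lookup)
               (SameRel-sym (≅⇒SameRel (proj₁ (proj₂ (proj₂ extension)))))
      where
      d-lookup : ∀ i → fun d i ≡ lookup (X ∷ʳ x (suc (suc (suc zero)))) i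
      d-lookup zero                   = refl
      d-lookup (suc zero)             = refl
      d-lookup (suc (suc zero))       = refl
      d-lookup (suc (suc (suc zero))) = refl

    pre : Fin 3 → ℕ
    pre zero             = x (suc zero)
    pre (suc zero)       = x (suc (suc zero))
    pre (suc (suc zero)) = y

    pre-monotone : ∀ i j → i Fin.< j → pre i < pre j
    pre-monotone zero (suc zero) _ = monotone d _ _ (s<s z<s)
    pre-monotone zero (suc (suc zero)) _ = ℕₚ.<-trans (monotone d _ _ (s<s z<s)) y>last
    pre-monotone (suc zero) (suc (suc zero)) _ = y>last
    pre-monotone (suc zero) (suc zero) (s<s ())
    pre-monotone (suc (suc zero)) (suc zero) (s<s ())
    pre-monotone (suc (suc zero)) (suc (suc zero)) (s<s (s<s ()))

    Y-leaf : ∀ i → lookup Y (suc i) ≡ fun f (pre i)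
    Y-leaf zero             = refl
    Y-leaf (suc zero)       = refl
    Y-leaf (suc (suc zero)) = refl

    e : Embedding A H
    e = record
      { fun      = fun f ∘ pre
      ; monotone = λ i j i<j → monotone f _ _ (pre-monotone i j i<j)
      ; relation = λ R xs →
          rel-reindex H suc Y-leaf xs
          ⇔-∘ (star-Y R (map suc xs) ⇔-∘ relation (leaves k) R xs)
      }

    inImage : ∀ v → ∃[ w ] fun e v ≡ fun f w
    inImage v = pre v , refl

    pair-type : ∀ i → SameRel (D k i) (induced H (fun f (x zero) ∷ fun f (pre i) ∷ []))
    pair-type i R xs =
      rel-reindex H (leaf i) pair-lookup xs
      ⇔-∘ (star-Y R (map (leaf i) xs) ⇔-∘ relation (leaf-embedding (D k) (roots k) i) R xs)
      where
      pair-lookup : ∀ a → lookup Y (leaf i a) ≡ lookup (fun f (x zero) ∷ fun f (pre i) ∷ []) a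
      pair-lookup zero       = refl
      pair-lookup (suc zero) = Y-leaf i

    codes : Codes (fun e zero) (fun e (suc (suc zero))) k
    -- The first difference is at the image of the root. The second type equality gives agreement
    -- below it; agreement at it would make `C k` and `C (suc k)` isomorphic.
    codes = fun f (x zero)
      , (λ w w< → SameRel-sym (below-pair H (proj₂ (proj₂ (proj₂ extension))) w w<))
      , (λ agree → distinct k (suc k) (ℕₚ.1+n≢n ∘ sym)
          (SameRel⇒≅ (SameRel-trans (pair-type zero)
            (SameRel-trans agree (SameRel-sym (pair-type (suc (suc zero))))))))
      , SameRel-sym (pair-type zero)
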